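{- Let $G$ be a group and $\precsim$ a quasi-order on $G$. Then $\precsim$ is a C-quasi-order if and only if the following three axioms are satisfied: $(CQ_1)$ for all $x\in G\setminus\{1\}$, $1\precnsim x$; $(CQ_2)$ for all $x,y\in G$, $x\precsim y\Leftrightarrow xy^{ -1}\precsim y^{ -1}$; $(CQ_3)$ for all $x,y,z\in G$, $x\precsim y\Leftrightarrow x^z\precsim y^z$, where $x^z:=zxz^{ -1}$.
   Context: A quasi-order is a reflexive, transitive and total binary relation $\precsim$; $a\sim b$ means $a\precsim b\precsim a$, and $a\precnsim b$ means $a\precsim b$ and $a\nsim b$. A C-relation on a set is a ternary relation $C$ such that for all $x,y,z,w$: $C(x,y,z)\Rightarrow C(x,z,y)$; $C(x,y,z)\Rightarrow\neg C(y,x,z)$; $C(x,y,z)\Rightarrow C(w,y,z)\vee C(x,w,z)$; $x\neq y\Rightarrow C(x,y,y)$. On a group it is compatible if $C(x,y,z)$ implies $C(vxu,vyu,vzu)$ for all $x,y,z,u,v$. A C-quasi-order on a group $G$ is a quasi-order of the form $x\precsim y\Leftrightarrow\neg C(x,y,1)$, where $C$ is a compatible C-relation on $G$. -}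

module Defs where

open import Algebra.Bundles using (Group)
open import Data.Product.Base using (_×_; ∃-syntax)
open import Data.Sum.Base using (_⊎_)
open import Function.Bundles using (_⇔_)
open import Level using (Level; _⊔_; suc)
open import Relation.Binary.Core using (Rel)
open import Relation.Binary.Structures using (IsTotalPreorder)
open import Relation.Binary.Construct.Interior.Symmetric using (SymInterior)
import Relation.Binary.Construct.NonStrictToStrict as NonStrictToStrict
open import Relation.Nullary.Negation using (¬_)

private
  variable
    a ℓ γ : Level

-- Sets are setoids here, so a relation on one has to respect its equality `_≈_`.
-- For `C` this is the field `resp`; for a quasi-order it is already part of
-- `IsTotalPreorder _≈_`, whose reflexivity reads `x ≈ y → x ≾ y`.
record IsCRelation {A : Set a} (_≈_ : Rel A ℓ) (C : A → A → A → Set γ)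
       : Set (a ⊔ ℓ ⊔ γ) where
  field
    resp   : ∀ {x x′ y y′ z z′} → x ≈ x′ → y ≈ y′ → z ≈ z′ →
             C x y z → C x′ y′ z′
    swap   : ∀ x y z → C x y z → C x z y
    asym   : ∀ x y z → C x y z → ¬ C y x z
    split  : ∀ x y z w → C x y z → C w y z ⊎ C x w z
    isolate : ∀ x y → ¬ (x ≈ y) → C x y y

module _ {c ℓ₁} (G : Group c ℓ₁) where
  open Group G

  Compatible : (Carrier → Carrier → Carrier → Set γ) → Set (c ⊔ γ)
  Compatible C = ∀ x y z u v → C x y z →
                 C (v ∙ x ∙ u) (v ∙ y ∙ u) (v ∙ z ∙ u)

  conj : Carrier → Carrier → Carrier
  conj x z = z ∙ x ∙ z ⁻¹

  module _ {ℓ₂} (_≾_ : Rel Carrier ℓ₂) where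

    IsQuasiOrder : Set (c ⊔ ℓ₁ ⊔ ℓ₂)
    IsQuasiOrder = IsTotalPreorder _≈_ _≾_

    record IsCQuasiOrder : Set (c ⊔ ℓ₁ ⊔ suc ℓ₂) where
      field
        isQuasiOrder : IsQuasiOrder
        inducedByC   : ∃[ C ] IsCRelation {γ = ℓ₂} _≈_ C × Compatible C ×
                              (∀ x y → (x ≾ y) ⇔ (¬ C x y ε))

    _∼_ : Rel Carrier ℓ₂
    _∼_ = SymInterior _≾_

    -- Strictness is relative to `_∼_`, not to the equality of the group.
    _≺_ : Rel Carrier ℓ₂
    _≺_ = NonStrictToStrict._<_ _∼_ _≾_

    CQ₁ : Set (c ⊔ ℓ₁ ⊔ ℓ₂)
    CQ₁ = ∀ x → ¬ (x ≈ ε) → ε ≺ x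

    CQ₂ : Set (c ⊔ ℓ₂)
    CQ₂ = ∀ x y → (x ≾ y) ⇔ ((x ∙ y ⁻¹) ≾ (y ⁻¹))

    CQ₃ : Set (c ⊔ ℓ₂)
    CQ₃ = ∀ x y z → (x ≾ y) ⇔ (conj x z ≾ conj y z)

{-# OPTIONS --safe #-}
module Submission where

-- Conversely to x ≾ y ⇔ ¬ C(x, y, 1), a compatible C has to be
-- C(x, y, z) ⇔ ¬ (x z⁻¹ ≾ y z⁻¹), by right translation with z⁻¹. For this
-- relation CQ₂, applied to x z⁻¹ and y z⁻¹, is the symmetry in the last two
-- arguments, CQ₃ is compatibility and CQ₁ is C(x, y, y) for x ≠ y.

open import Defs
open import Algebra.Bundles using (Group)
import Algebra.Properties.Group as GroupProperties
open import Axiom.ExcludedMiddle using (ExcludedMiddle)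
open import Data.Product.Base using (_×_; _,_)
open import Data.Sum.Base using (_⊎_; inj₁; inj₂; [_,_]′)
open import Function.Base using (_∘_)
open import Function.Bundles using (_⇔_; mk⇔; module Equivalence)
open import Function.Construct.Composition using (_⇔-∘_)
open import Function.Construct.Symmetry using (⇔-sym)
open import Function.Related.TypeIsomorphisms using (¬-cong-⇔)
open import Relation.Binary.Construct.Interior.Symmetric using (_,_)
open import Relation.Binary.Core using (Rel)
import Relation.Binary.Reasoning.Setoid as SetoidReasoning
open import Relation.Binary.Structures using (IsTotalPreorder)
open import Relation.Nullary.Decidable.Core using (yes; no; decidable-stable)
open import Relation.Nullary.Negation using (¬_)

open Equivalence using (to; from)

module _ {c ℓ} (G : Group c ℓ) where
  open Group G
  open GroupProperties G
  open SetoidReasoning setoid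

  -- This cancellation serves twice: for the right factor in compatibility and, with an inverse as
  -- the factor, for the common denominator in the swap axiom.
  translate-// : ∀ x y z → (x ∙ z) // (y ∙ z) ≈ x // y
  translate-// x y z = begin
    (x ∙ z) ∙ (y ∙ z) ⁻¹    ≈⟨ ∙-congˡ (⁻¹-anti-homo-∙ y z) ⟩
    (x ∙ z) ∙ (z ⁻¹ ∙ y ⁻¹) ≈⟨ assoc (x ∙ z) (z ⁻¹) (y ⁻¹) ⟨
    ((x ∙ z) // z) ∙ y ⁻¹   ≈⟨ ∙-congʳ (//-rightDividesʳ z x) ⟩
    x // y                  ∎

  conj-// : ∀ x y z → (z ∙ x) // (z ∙ y) ≈ conj G (x // y) z
  conj-// x y z = begin
    (z ∙ x) ∙ (z ∙ y) ⁻¹    ≈⟨ ∙-congˡ (⁻¹-anti-homo-∙ z y) ⟩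
    (z ∙ x) ∙ (y ⁻¹ ∙ z ⁻¹) ≈⟨ assoc (z ∙ x) (y ⁻¹) (z ⁻¹) ⟨
    ((z ∙ x) ∙ y ⁻¹) ∙ z ⁻¹ ≈⟨ ∙-congʳ (assoc z x (y ⁻¹)) ⟩
    conj G (x // y) z       ∎

  conj-inverse : ∀ x z → conj G (conj G x z) (z ⁻¹) ≈ x
  conj-inverse x z = begin
    z ⁻¹ ∙ ((z ∙ x) ∙ z ⁻¹) ∙ z ⁻¹ ⁻¹ ≈⟨ ∙-congʳ (∙-congˡ (assoc z x (z ⁻¹))) ⟩
    z ⁻¹ ∙ (z ∙ (x ∙ z ⁻¹)) ∙ z ⁻¹ ⁻¹ ≈⟨ ∙-congʳ (\\-leftDividesʳ z (x ∙ z ⁻¹)) ⟩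
    (x ∙ z ⁻¹) ∙ z ⁻¹ ⁻¹              ≈⟨ //-rightDividesʳ (z ⁻¹) x ⟩
    x                                 ∎

  conj-ε : ∀ z → conj G ε z ≈ ε
  conj-ε z = trans (∙-congʳ (identityʳ z)) (inverseʳ z)

  module _ {γ} {C : Carrier → Carrier → Carrier → Set γ}
           (isC : IsCRelation _≈_ C) (compatible : Compatible G C) where
    open IsCRelation isC

    C-translateʳ : ∀ {x y z} u → C x y z → C (x ∙ u) (y ∙ u) (z ∙ u)
    C-translateʳ {x} {y} {z} u =
      resp (∙-congʳ (identityˡ x)) (∙-congʳ (identityˡ y)) (∙-congʳ (identityˡ z))
      ∘ compatible x y z u ε

    -- Right translation by `y ⁻¹` puts `ε` in the second place and `y ⁻¹` in the last; `swap`
    -- exchanges them. Translation by `y` undoes this.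
    C-divide : ∀ x y → C x y ε ⇔ C (x ∙ y ⁻¹) (y ⁻¹) ε
    C-divide x y = mk⇔
      (swap _ _ _ ∘ resp refl (inverseʳ y) (identityˡ (y ⁻¹)) ∘ C-translateʳ (y ⁻¹))
      (resp (//-rightDividesˡ y x) (identityˡ y) (inverseˡ y) ∘ C-translateʳ y ∘ swap _ _ _)

    -- Conjugation is a two-sided translation that fixes `ε`, so the last place is kept; conjugation
    -- by `z ⁻¹` gives the converse.
    C-conj : ∀ x y z → C x y ε ⇔ C (conj G x z) (conj G y z) ε
    C-conj x y z = mk⇔
      (conjugate z)
      (resp (conj-inverse x z) (conj-inverse y z) refl ∘ conjugate (z ⁻¹))
      where
      conjugate : ∀ {x y} z → C x y ε → C (conj G x z) (conj G y z) ε
      conjugate z = resp refl refl (conj-ε z) ∘ compatible _ _ ε (z ⁻¹) z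

  module _ {ℓ₂} {_≾_ : Rel Carrier ℓ₂} where

    CQ-axioms : IsCQuasiOrder G _≾_ → CQ₁ G _≾_ × CQ₂ G _≾_ × CQ₃ G _≾_
    CQ-axioms record { inducedByC = C , isC , compatible , induced } = cq₁ , cq₂ , cq₃
      where
      open IsCRelation isC

      ≾-cong : ∀ {x y x′ y′} → C x y ε ⇔ C x′ y′ ε → (x ≾ y) ⇔ (x′ ≾ y′)
      ≾-cong e = ⇔-sym (induced _ _) ⇔-∘ (¬-cong-⇔ e ⇔-∘ induced _ _)

      cq₁ : CQ₁ G _≾_
      cq₁ x x≉ε =
        -- `C ε x ε` would swap to `C ε ε x`, whose first two entries agree, so asymmetry turns it
        -- against itself.
        from (induced ε x) (λ c → asym ε ε x (swap ε x ε c) (swap ε x ε c)) ,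
        λ where (_ , x≾ε) → to (induced x ε) x≾ε (isolate x ε x≉ε)

      cq₂ : CQ₂ G _≾_
      cq₂ x y = ≾-cong (C-divide isC compatible x y)

      cq₃ : CQ₃ G _≾_
      cq₃ x y z = ≾-cong (C-conj isC compatible x y z)

    module _ (em : ExcludedMiddle ℓ₂) (isQO : IsQuasiOrder G _≾_)
             (cq₁ : CQ₁ G _≾_) (cq₂ : CQ₂ G _≾_) (cq₃ : CQ₃ G _≾_) where
      private module QO = IsTotalPreorder isQO

      ≾-resp-≈ : ∀ {x y x′ y′} → x ≈ x′ → y ≈ y′ → x ≾ y → x′ ≾ y′
      ≾-resp-≈ x≈x′ y≈y′ x≾y =
        QO.trans (QO.reflexive (sym x≈x′)) (QO.trans x≾y (QO.reflexive y≈y′))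

      D : Carrier → Carrier → Carrier → Set ℓ₂
      D x y z = ¬ ((x // z) ≾ (y // z))

      D-isCRelation : IsCRelation _≈_ D
      D-isCRelation = record
        { resp    = λ x≈x′ y≈y′ z≈z′ d →
            d ∘ ≾-resp-≈ (sym (//-cong₂ x≈x′ z≈z′)) (sym (//-cong₂ y≈y′ z≈z′))
        -- Here `CQ₂` fits because the quotient of `x // z` by `y // z` is `x // y`, and the inverse
        -- of `y // z` is `z // y`.
        ; swap    = λ x y z d → d ∘ from (cq₂ _ _) ∘
            ≾-resp-≈ (sym (divide x y z)) (sym (⁻¹-anti-homo-// y z))
        ; asym    = λ x y z x≴y y≴x → [ x≴y , y≴x ]′ (QO.total _ _)
        ; split   = split
        -- If `x // y ≾ ε` held, `x // y` would be equivalent to `ε`, against the strictness in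
        -- `CQ₁`.
        ; isolate = λ x y x≉y x≾ε →
            let ε≾ , ε≁ = cq₁ (x // y) (x≉y ∘ x∙y⁻¹≈ε⇒x≈y x y)
            in ε≁ (ε≾ , ≾-resp-≈ refl (inverseʳ y) x≾ε)
        }
        where
        divide : ∀ x y z → (x // z) // (y // z) ≈ x // y
        divide x y z = translate-// x y (z ⁻¹)

        -- Contrapositive of transitivity through `w // z`; excluded middle decides which of the two
        -- inequalities fails.
        split : ∀ x y z w → D x y z → D w y z ⊎ D x w z
        split x y z w d with em {(w // z) ≾ (y // z)}
        ... | yes w≾y = inj₂ λ x≾w → d (QO.trans x≾w w≾y)
        ... | no  w≴y = inj₁ w≴y

      -- In each quotient the right factor `u` cancels, while the left factor `v` survives as a
      -- conjugation, which `CQ₃` removes.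
      D-compatible : Compatible G D
      D-compatible x y z u v d =
        d ∘ from (cq₃ _ _ v) ∘ ≾-resp-≈ (quotient x) (quotient y)
        where
        quotient : ∀ x → (v ∙ x ∙ u) // (v ∙ z ∙ u) ≈ conj G (x // z) v
        quotient x = trans (translate-// (v ∙ x) (v ∙ z) u) (conj-// x z v)

      -- Division by `ε` changes nothing, so `D x y ε` amounts to the negation of `x ≾ y`; the
      -- backward direction is double negation elimination.
      D-induces : ∀ x y → (x ≾ y) ⇔ (¬ D x y ε)
      D-induces x y = mk⇔
        (λ x≾y d → d (≾-resp-≈ (sym (//-ε x)) (sym (//-ε y)) x≾y))
        (≾-resp-≈ (//-ε x) (//-ε y) ∘ decidable-stable em)
        where
        //-ε : ∀ x → x // ε ≈ x
        //-ε x = trans (∙-congˡ ε⁻¹≈ε) (identityʳ x)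

      isCQuasiOrder : IsCQuasiOrder G _≾_
      isCQuasiOrder = record
        { isQuasiOrder = isQO
        ; inducedByC   = D , D-isCRelation , D-compatible , D-induces
        }

proposition2p6 : ∀ {c ℓ₁ ℓ₂} → ExcludedMiddle ℓ₂ →
    (G : Group c ℓ₁) (_≾_ : Rel (Group.Carrier G) ℓ₂) →
    IsQuasiOrder G _≾_ →
    IsCQuasiOrder G _≾_ ⇔ (CQ₁ G _≾_ × CQ₂ G _≾_ × CQ₃ G _≾_)
proposition2p6 em G _≾_ isQO = mk⇔
  (CQ-axioms G)
  λ where (cq₁ , cq₂ , cq₃) → isCQuasiOrder G em isQO cq₁ cq₂ cq₃
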